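{- Let $\lambda$ be an infinite cardinal, let $G_1$ be a locally finite group of cardinality $\le\lambda$, and let $G_2\supseteq G_1$ be a locally finite group of cardinality $\le\mu$, where $\mu=\mu^\lambda$ (e.g. $G_1,G_2$ are of cardinality $\lambda$ and $\mu=2^\lambda$). Then there is a pair $(G_3,X)$ such that: (a) $G_2\subseteq G_3$ and $G_3$ is a locally finite group of cardinality $\mu$; (b) $X\subseteq G_3$ has cardinality $\le 2^\lambda$; (c) for every $c\in G_3$ exactly one of the following occurs: $(\alpha)$ $c\in X$ and $\{b\in G_3:\mathrm{tp}_{\mathrm{at}}(b,G_1,G_3)=\mathrm{tp}_{\mathrm{at}}(c,G_1,G_3)\}$ is a singleton (and this holds also in $G_4$ in place of $G_3$ whenever $G_3\subseteq G_4$ and $G_4$ is a locally finite group); $(\beta)$ there are $\|G_3\|$ elements of $G_3$ realizing $\mathrm{tp}_{\mathrm{bs}}(c,G_1,G_3)$; (d) if $\alpha<\lambda^+$, $\bar a\in{}^\alpha(G_3)$, $p(\bar x_{[\alpha]})=\mathrm{tp}_{\mathrm{at}}(\bar a,G_1,G_3)$ and $p'(\bar x_{[\alpha]})=\mathrm{tp}_{\mathrm{bs}}(\bar a,G_1,G_3)$, then there is a non-empty family $\mathcal{P}$ of subsets of $\alpha$, closed under intersections of two members and with $\alpha\in\mathcal{P}$, such that: $(\alpha)$ if $\bar a',\bar a''\in{}^\alpha(G_3)$ realize $p(\bar x_{[\alpha]})$, then $\{\beta<\alpha:a'_\beta=a''_\beta\}\in\mathcal{P}$; $(\beta)$ if $u\in\mathcal{P}$,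 then there is a sequence $\langle\bar a_\varepsilon:\varepsilon<\|G_3\|\rangle$ of members of ${}^\alpha(G_3)$, $\bar a_\varepsilon=\langle a_{\varepsilon,\beta}:\beta<\alpha\rangle$, which is a $\Delta$-system with heart $u$, i.e. $a_{\varepsilon_1,\beta_1}=a_{\varepsilon_2,\beta_2}$ if and only if $(\varepsilon_1,\beta_1)=(\varepsilon_2,\beta_2)$ or $\beta_1=\beta_2\in u$, and each $\bar a_\varepsilon$ realizes $p(\bar x_{[\alpha]})$ and even $p'(\bar x_{[\alpha]})$.
   Context: A group is locally finite if each finitely generated subgroup is finite. $G\subseteq H$ means $G$ is a subgroup of $H$; $\|G\|$ is the cardinality of $G$. ${}^\alpha G$ is the set of sequences of length $\alpha$ of elements of $G$, and $\bar x_{[\alpha]}=\langle x_\beta:\beta<\alpha\rangle$. For $G\subseteq H$ and a sequence $\bar a$ from $H$ (possibly infinite, each formula using only finitely many variables): $\mathrm{tp}_{\mathrm{at}}(\bar a,G,H)$ is the set of atomic formulas (group-word equations) in the variables $\bar x$ with parameters from $G$ satisfied by $\bar a$ in $H$; $\mathrm{tp}_{\mathrm{bs}}(\bar a,G,H)$ is the set of basic formulas (atomic formulas and negations of atomic formulas) in $\bar x$ with parameters from $G$ satisfied by $\bar a$ in $H$. A sequence realizes a type if it satisfies all formulas in it.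
   Formalization: In (d)(β) the equivalence is not required at β₁≠β₂ with ā_{β₁}=ā_{β₂}: there p forces equal entries, so the printed condition fails (e.g. ā=(e,e), u=α). Also μ is taken infinite (excluding only μ=1), and all groups, G₄ included, lie in one arbitrary universe. -}

module Defs where

open import Level using (Level; _⊔_; suc)
open import Algebra.Bundles using (Group)
open import Algebra.Morphism.Structures using (module GroupMorphisms)
import Algebra.Morphism.Construct.Composition as Comp
open import Data.Fin.Base using (Fin)
open import Data.Nat.Base using (ℕ)
open import Data.Product using (Σ; ∃; _×_; _,_; proj₁)
open import Data.Sum using (_⊎_)
open import Data.Unit.Base using (⊤)
open import Function.Base using (_∘_)
open import Function.Bundles using (Injection; Bijection; _⇔_)
open import Induction.WellFounded using (WellFounded)
open import Relation.Binary.Bundles using (Setoid)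
open import Relation.Binary.Core using (Rel)
open import Relation.Binary.Structures using (IsStrictTotalOrder)
import Relation.Binary.Construct.On as On
open import Relation.Binary.PropositionalEquality using (_≡_; setoid)
open import Relation.Nullary.Negation using (¬_)
open import Relation.Unary using (Pred; _∈_; _≐_)

-- A cardinal is represented by any type of that cardinality.  The underlying
-- set of a group is a setoid, so its cardinality is that of the quotient.

infix 4 ∣_∣≤_ ∣_∣≡_

∣_∣≤_ : ∀ {a b ℓ} → Setoid a ℓ → Set b → Set (a ⊔ b ⊔ ℓ)
∣ S ∣≤ K = Injection S (setoid K)

∣_∣≡_ : ∀ {a b ℓ} → Setoid a ℓ → Set b → Set (a ⊔ b ⊔ ℓ)
∣ S ∣≡ K = Bijection S (setoid K)

Finite : ∀ {a ℓ} → Setoid a ℓ → Set (a ⊔ ℓ)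
Finite S = ∃ λ (n : ℕ) → ∣ S ∣≡ Fin n

Infinite : ∀ {a} → Set a → Set a
Infinite K = ¬ Finite (setoid K)

record Ordinal (ℓ : Level) : Set (suc ℓ) where
  infix 4 _<_
  field
    Index              : Set ℓ
    _<_                : Rel Index ℓ
    isStrictTotalOrder : IsStrictTotalOrder _≡_ _<_
    wellFounded        : WellFounded _<_

-- α < λ⁺ holds exactly when the set of predecessors of α has cardinality ≤ λ.
infix 4 _<_⁺
_<_⁺ : ∀ {ℓ b} → Ordinal ℓ → Set b → Set (ℓ ⊔ b)
α < K ⁺ = ∣ setoid (Ordinal.Index α) ∣≤ K

subset : ∀ {a ℓ p} (S : Setoid a ℓ) → Pred (Setoid.Carrier S) p → Setoid (a ⊔ p) ℓ
subset S P = On.setoid {B = Σ (Setoid.Carrier S) P} S proj₁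

IsSingleton : ∀ {a ℓ p} (S : Setoid a ℓ) → Pred (Setoid.Carrier S) p → Set (a ⊔ ℓ ⊔ p)
IsSingleton S P = ∃ λ x → x ∈ P × (∀ y → y ∈ P → y ≈ x)
  where open Setoid S

module _ {c ℓ} (G : Group c ℓ) where
  open Group G

  data ⟨_⟩ {p} (P : Pred Carrier p) : Pred Carrier (c ⊔ ℓ ⊔ p) where
    gen  : ∀ {x}   → x ∈ P → ⟨ P ⟩ x
    unit : ⟨ P ⟩ ε
    mult : ∀ {x y} → ⟨ P ⟩ x → ⟨ P ⟩ y → ⟨ P ⟩ (x ∙ y)
    inv  : ∀ {x}   → ⟨ P ⟩ x → ⟨ P ⟩ (x ⁻¹)
    resp : ∀ {x y} → x ≈ y → ⟨ P ⟩ x → ⟨ P ⟩ y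

  LocallyFinite : Set (c ⊔ ℓ)
  LocallyFinite = ∀ n (g : Fin n → Carrier) →
    Finite (subset (Group.setoid G) ⟨ (λ x → ∃ λ i → x ≡ g i) ⟩)

-- "G is a subgroup of H", presented by the inclusion map.
infix 4 _≤ᴳ_
record _≤ᴳ_ {a ℓ₁ b ℓ₂} (G : Group a ℓ₁) (H : Group b ℓ₂) : Set (a ⊔ ℓ₁ ⊔ b ⊔ ℓ₂) where
  open GroupMorphisms (Group.rawGroup G) (Group.rawGroup H)
  field
    incl                : Group.Carrier G → Group.Carrier H
    isGroupMonomorphism : IsGroupMonomorphism incl

infixr 9 _⨾_
_⨾_ : ∀ {a ℓ₁ b ℓ₂ c ℓ₃} {G : Group a ℓ₁} {H : Group b ℓ₂} {K : Group c ℓ₃} →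
      G ≤ᴳ H → H ≤ᴳ K → G ≤ᴳ K
_⨾_ {K = K} ι κ = record
  { incl                = _≤ᴳ_.incl κ ∘ _≤ᴳ_.incl ι
  ; isGroupMonomorphism = Comp.isGroupMonomorphism (Group.trans K)
      (_≤ᴳ_.isGroupMonomorphism ι) (_≤ᴳ_.isGroupMonomorphism κ)
  }

infixl 7 _·_
infix  4 _≗_

data Word {v c} (V : Set v) (C : Set c) : Set (v ⊔ c) where
  var   : V → Word V C
  param : C → Word V C
  one   : Word V C
  _·_   : Word V C → Word V C → Word V C
  _⁻    : Word V C → Word V C

data Atomic {v c} (V : Set v) (C : Set c) : Set (v ⊔ c) where
  _≗_ : Word V C → Word V C → Atomic V C

data Basic {v c} (V : Set v) (C : Set c) : Set (v ⊔ c) where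
  pos neg : Atomic V C → Basic V C

module _ {a ℓ₁ b ℓ₂} {G : Group a ℓ₁} {H : Group b ℓ₂} (ι : G ≤ᴳ H)
         {v} {V : Set v} (ā : V → Group.Carrier H) where
  open Group H

  eval : Word V (Group.Carrier G) → Carrier
  eval (var x)   = ā x
  eval (param g) = _≤ᴳ_.incl ι g
  eval one       = ε
  eval (s · t)   = eval s ∙ eval t
  eval (s ⁻)     = eval s ⁻¹

  tp-at : Pred (Atomic V (Group.Carrier G)) ℓ₂
  tp-at (s ≗ t) = eval s ≈ eval t

  tp-bs : Pred (Basic V (Group.Carrier G)) ℓ₂
  tp-bs (pos φ) = tp-at φ
  tp-bs (neg φ) = ¬ tp-at φ

  Realizes-at : ∀ {p} → Pred (Atomic V (Group.Carrier G)) p → Set (v ⊔ a ⊔ ℓ₂ ⊔ p)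
  Realizes-at p = ∀ φ → φ ∈ p → φ ∈ tp-at

  Realizes-bs : ∀ {p} → Pred (Basic V (Group.Carrier G)) p → Set (v ⊔ a ⊔ ℓ₂ ⊔ p)
  Realizes-bs p = ∀ φ → φ ∈ p → φ ∈ tp-bs

-- An element, as a sequence of length one.
⟪_⟫ : ∀ {a} {A : Set a} → A → ⊤ → A
⟪ x ⟫ _ = x

module _ {a ℓ₁ b ℓ₂} {G : Group a ℓ₁} {H : Group b ℓ₂} (ι : G ≤ᴳ H) where
  open Group H using (Carrier)

  SameAtomicType : Carrier → Pred Carrier (a ⊔ ℓ₂)
  SameAtomicType c b = tp-at ι ⟪ b ⟫ ≐ tp-at ι ⟪ c ⟫

  RealizesBasicType : Carrier → Pred Carrier (a ⊔ ℓ₂)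
  RealizesBasicType c b = Realizes-bs ι ⟪ b ⟫ (tp-bs ι ⟪ c ⟫)

ExactlyOne : ∀ {p q} → Set p → Set q → Set (p ⊔ q)
ExactlyOne P Q = (P × ¬ Q) ⊎ (¬ P × Q)

-- The sequences as ε in a Δ-system are all meant to realize the atomic type of
-- a given sequence ā.  If ā repeats an entry, ā β₁ ≈ ā β₂ with β₁ ≢ β₂, then
-- as ε β₁ ≈ as ε β₂ is forced for every ε, and the defining equivalence fails.
-- It is therefore required at all pairs β₁, β₂ other than the repetitions
-- of ā; when ā has no repetitions, this is every pair.
IsΔSystem : ∀ {e i a ℓ u} (S : Setoid a ℓ) {E : Set e} {I : Set i}
            (ā : I → Setoid.Carrier S) (as : E → I → Setoid.Carrier S)
            (heart : Pred I u) → Set (e ⊔ i ⊔ ℓ ⊔ u)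
IsΔSystem S {E} {I} ā as heart =
  ∀ (ε₁ ε₂ : E) (β₁ β₂ : I) →
  (ā β₁ ≈ ā β₂ → β₁ ≡ β₂) →
  as ε₁ β₁ ≈ as ε₂ β₂ ⇔
    ((ε₁ , β₁) ≡ (ε₂ , β₂) ⊎ (β₁ ≡ β₂ × β₁ ∈ heart))
  where open Setoid S

{-# OPTIONS --safe #-}
-- Let K be the semidirect product of G₂ with the Z/2-space on the cosets
-- G₂ / G₁.  Conjugation by the coset G₁ fixes G₁ and moves every x ∈ G₂ ∖ G₁, and
-- the retraction of K onto G₂ moves everything outside G₂; so every element of K
-- outside G₁ has two distinct images under endomorphisms of K over G₁.
-- Let G₃ be the group of functions {0,1}^D → K depending on finitely many
-- coordinates, where |D| = μ and any λ elements of G₃ leave μ coordinates unused.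
-- If a′ and a″ realize the atomic type of ā, then a fresh coordinate for each
-- ε < μ gives the sequence equal to a′ where this bit is 1 and to a″ where it is
-- 0, and a further fresh bit, common to all ε, switches this sequence to ā.  These
-- sequences realize the basic type of ā and form a Δ-system whose heart is the set
-- where a′ and a″ agree.  A non-constant c ∈ G₃ has two of its values, and a
-- constant c ∉ G₁ has two images under endomorphisms, as distinct realizers of its
-- atomic type; hence X = G₁ works.
module Submission where

open import Defs
open import Algebra.Bundles using (Group)
import Algebra.Morphism.Construct.Identity as Identity
open import Algebra.Morphism.Structures using (module GroupMorphisms)
import Algebra.Properties.Group as GroupProperties
open import Axiom.ExcludedMiddle using (ExcludedMiddle)
open import Axiom.Extensionality.Propositional using (Extensionality)
open import Data.Bool.Base using (Bool; true; false; if_then_else_; _xor_)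
open import Data.Bool.Properties using (xor-assoc; xor-same; xor-identityʳ; ¬-not)
open import Data.Fin.Base using (Fin; zero; suc; finToFun; funToFin; remQuot; combine)
open import Data.Fin.Properties using (suc-injective; finToFun-funToFin; 2↔Bool; remQuot-combine; combine-injective)
open import Data.List.Base using (List; []; _∷_; map; length; lookup; _++_; concat; tabulate)
open import Data.List.Membership.Propositional using (_∉_) renaming (_∈_ to _∈ˡ_)
open import Data.List.Membership.Propositional.Properties using (∈-++⁺ˡ; ∈-++⁺ʳ; ∈-concat⁺′; ∈-tabulate⁺; ∈-map⁺)
open import Data.List.Properties using (∷-injectiveˡ; ∷-injectiveʳ; map-injective)
open import Data.List.Relation.Unary.Any using (index; here; there)
open import Data.List.Relation.Unary.Any.Properties using (lookup-index)
open import Data.Nat.Base using (ℕ; zero; suc; _^_; _*_)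
open import Data.Product using (Σ; Σ-syntax; ∃; _×_; _,_; proj₁; proj₂)
open import Data.Product.Properties using (,-injective)
open import Data.Sum using (inj₁; inj₂)
import Data.Unit.Base as Unit
open import Data.Unit.Polymorphic.Base using (⊤; tt)
open import Function.Base using (_∘_; id)
open import Function.Bundles using (Injection; Bijection; _⤖_; mk⇔; Inverse)
open import Function.Definitions using (Injective)
open import Function.Properties.Bijection using (sym-≡) renaming (trans to bijection-trans)
open import Function.Properties.Inverse using (↔⇒↣; ↔-sym)
open import Level using (Level; _⊔_)
open import Relation.Binary.Bundles using (Setoid)
open import Relation.Binary.Definitions using (_Respects_)
open import Relation.Binary.PropositionalEquality using (_≡_; _≢_; refl; sym; trans; cong; subst; cong₂) renaming (setoid to ≡-setoid)
open import Relation.Nullary using (¬_; yes; no; does)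
open import Relation.Nullary.Decidable using (dec-true; dec-false; does-⇔; decidable-stable)
open import Relation.Nullary.Negation using (contradiction)
open import Relation.Unary using (Pred; _∩_; _≐_; _∈_; Satisfiable)
open import Relation.Unary.Properties using (≐-refl; ≐-sym; ≐-trans)

-- Auxiliary notions for bijections, homomorphisms and endomorphisms over a subgroup.

module _ {a k} {A : Set a} {K : Set k} (f : A → K) (g : K → A) where

  -- The dividing set of the Schröder-Bernstein argument: the bijection follows `g` on it and
  -- inverts `f` off it.
  data Moved : K → Set (a ⊔ k) where
    base : ∀ {x} → (∀ y → f y ≢ x) → Moved x
    step : ∀ {x} → Moved x → Moved (f (g x))

module _ {a ℓ₁ b ℓ₂} (G : Group a ℓ₁) (H : Group b ℓ₂) where
  private
    module G = Group G
    module H = Group H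
  open GroupMorphisms G.rawGroup H.rawGroup

  ∙-homo⇒isGroupHomomorphism : {φ : G.Carrier → H.Carrier} →
    (∀ {x y} → x G.≈ y → φ x H.≈ φ y) → (∀ x y → φ (x G.∙ y) H.≈ φ x H.∙ φ y) →
    IsGroupHomomorphism φ
  ∙-homo⇒isGroupHomomorphism {φ} φ-cong φ-homo = record
    { isMonoidHomomorphism = record
      { isMagmaHomomorphism = record
        { isRelHomomorphism = record { cong = φ-cong }
        ; homo = φ-homo
        }
      ; ε-homo = ε-homo
      }
    ; ⁻¹-homo = λ x → inverseˡ-unique (φ (x G.⁻¹)) (φ x)
        (H.trans (H.sym (φ-homo (x G.⁻¹) x)) (H.trans (φ-cong (G.inverseˡ x)) ε-homo))
    }
    where
    open GroupProperties H using (inverseˡ-unique; identityˡ-unique)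
    ε-homo : φ G.ε H.≈ H.ε
    ε-homo = identityˡ-unique (φ G.ε) (φ G.ε)
      (H.trans (H.sym (φ-homo G.ε G.ε)) (φ-cong (G.identityˡ G.ε)))

module _ {a ℓ₁ b ℓ₂} {G : Group a ℓ₁} {H : Group b ℓ₂} (ι : G ≤ᴳ H) where
  private
    module H = Group H
    incl = _≤ᴳ_.incl ι
  open GroupMorphisms H.rawGroup H.rawGroup using (IsGroupHomomorphism)

  EndomorphismOver : (H.Carrier → H.Carrier) → Set (a ⊔ b ⊔ ℓ₂)
  EndomorphismOver φ = IsGroupHomomorphism φ × (∀ g → φ (incl g) H.≈ incl g)

  -- Endomorphisms over the base preserve equations with parameters from it, so `φ x` and `ψ x` are
  -- two different realizers of the atomic type of `x`.
  Separated : Set (a ⊔ b ⊔ ℓ₂)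
  Separated = ∀ x → ¬ (∃ λ g → incl g H.≈ x) → Σ[ φ ∈ (H.Carrier → H.Carrier) ] Σ[ ψ ∈ (H.Carrier → H.Carrier) ]
    EndomorphismOver φ × EndomorphismOver ψ × ¬ φ x H.≈ ψ x

-- The group of functions depending on finitely many coordinates.

module Power {ℓ} (D : Set ℓ) (K : Group ℓ ℓ) where
  private module K = Group K

  Point : Set ℓ
  Point = D → Bool

  AgreeOn : List D → Point → Point → Set ℓ
  AgreeOn F i j = ∀ {d} → d ∈ˡ F → i d ≡ j d

  -- The support is kept as data so that fresh coordinates and codes can be read off an element. It
  -- need not be minimal, and equality in `power` ignores it.
  record LocallyConstant : Set ℓ where
    field
      at      : Point → K.Carrier
      support : List D
      local   : ∀ {i j} → AgreeOn support i j → at i K.≈ at j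
  open LocallyConstant public

  pointwise₂ : (_⊙_ : K.Carrier → K.Carrier → K.Carrier) →
               (∀ {x y u v} → x K.≈ y → u K.≈ v → (x ⊙ u) K.≈ (y ⊙ v)) →
               LocallyConstant → LocallyConstant → LocallyConstant
  pointwise₂ _⊙_ ⊙-cong f g = record
    { at      = λ j → at f j ⊙ at g j
    ; support = support f ++ support g
    ; local   = λ agree → ⊙-cong (local f (λ d∈ → agree (∈-++⁺ˡ d∈)))
                                 (local g (λ d∈ → agree (∈-++⁺ʳ (support f) d∈)))
    }

  constant : K.Carrier → LocallyConstant
  constant x = record { at = λ _ → x ; support = [] ; local = λ _ → K.refl }

  power : Group ℓ ℓ
  power = record
    { Carrier = LocallyConstant
    ; _≈_     = λ f g → ∀ j → at f j K.≈ at g j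
    ; _∙_     = pointwise₂ K._∙_ K.∙-cong
    ; ε       = constant K.ε
    ; _⁻¹     = λ f → record { at = λ j → at f j K.⁻¹ ; support = support f
                             ; local = λ agree → K.⁻¹-cong (local f agree) }
    ; isGroup = record
      { isMonoid = record
        { isSemigroup = record
          { isMagma = record
            { isEquivalence = record
              { refl  = λ _ → K.refl
              ; sym   = λ e j → K.sym (e j)
              ; trans = λ e e′ j → K.trans (e j) (e′ j)
              }
            ; ∙-cong = λ e e′ j → K.∙-cong (e j) (e′ j)
            }
          ; assoc = λ f g h j → K.assoc (at f j) (at g j) (at h j)
          }
        ; identity = (λ f j → K.identityˡ (at f j)) , (λ f j → K.identityʳ (at f j))
        }
      ; inverse = (λ f j → K.inverseˡ (at f j)) , (λ f j → K.inverseʳ (at f j))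
      ; ⁻¹-cong = λ e j → K.⁻¹-cong (e j)
      }
    }

  diagonal : K ≤ᴳ power
  diagonal = record
    { incl = constant
    ; isGroupMonomorphism = record
      { isGroupHomomorphism = record
        { isMonoidHomomorphism = record
          { isMagmaHomomorphism = record
            { isRelHomomorphism = record { cong = λ e _ → e }
            ; homo = λ _ _ _ → K.refl
            }
          ; ε-homo = λ _ → K.refl
          }
        ; ⁻¹-homo = λ _ _ → K.refl
        }
      ; injective = λ e → e (λ _ → false)
      }
    }

  mix : D → LocallyConstant → LocallyConstant → LocallyConstant
  mix d f g = record
    { at      = λ j → if j d then at f j else at g j
    ; support = d ∷ support f ++ support g
    ; local   = λ {i} {j} agree → if-cong (agree (here refl))
        (local f (λ d∈ → agree (there (∈-++⁺ˡ d∈))))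
        (local g (λ d∈ → agree (there (∈-++⁺ʳ (support f) d∈))))
    }
    where
    if-cong : ∀ {b c x y u v} → b ≡ c → x K.≈ y → u K.≈ v →
              (if b then x else u) K.≈ (if c then y else v)
    if-cong {true}  refl e _ = e
    if-cong {false} refl _ e = e

-- Coding finite sequences by single elements.

module Codes {m} {M : Set m} (pair : M × M → M) (pair-injective : Injective _≡_ _≡_ pair)
             {m₀ m₁ : M} (m₀≢m₁ : m₀ ≢ m₁) where

  pair-injective₂ : ∀ {w x y z} → pair (w , x) ≡ pair (y , z) → w ≡ y × x ≡ z
  pair-injective₂ e = ,-injective (pair-injective e)

  list : List M → M
  list []       = pair (m₀ , m₀)
  list (x ∷ xs) = pair (m₁ , pair (x , list xs))

  list-injective : Injective _≡_ _≡_ list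
  list-injective {[]}    {[]}    e = refl
  list-injective {[]}    {_ ∷ _} e = contradiction (proj₁ (pair-injective₂ e)) m₀≢m₁
  list-injective {_ ∷ _} {[]}    e = contradiction (sym (proj₁ (pair-injective₂ e))) m₀≢m₁
  list-injective {_ ∷ _} {_ ∷ _} e =
    let x≡y , e′ = pair-injective₂ (proj₂ (pair-injective₂ e)) in cong₂ _∷_ x≡y (list-injective e′)

  -- Codes are compared only at the same length `n`, so the tags `m₀` and `m₁`, which mark the end
  -- of the sequence in `list`, do not occur here.
  tuple : ∀ n → (Fin n → M) → M
  tuple zero    f = m₀
  tuple (suc n) f = pair (f zero , tuple n (f ∘ suc))

  tuple-injective : ∀ n {f g} → tuple n f ≡ tuple n g → ∀ i → f i ≡ g i
  tuple-injective (suc n) e zero    = proj₁ (pair-injective₂ e)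
  tuple-injective (suc n) e (suc i) = tuple-injective n (proj₂ (pair-injective₂ e)) i

-- Choice from excluded middle, and comparison of cardinals.

module Classical (em : ∀ a → ExcludedMiddle a) (ext : ∀ a b → Extensionality a b) where

  χ : ∀ {p} → Set p → Bool
  χ P = does (em _ {P})

  χ-true : ∀ {p} {P : Set p} → P → χ P ≡ true
  χ-true = dec-true (em _)

  χ-false : ∀ {p} {P : Set p} → ¬ P → χ P ≡ false
  χ-false = dec-false (em _)

  χ-cong : ∀ {p q} {P : Set p} {Q : Set q} → (P → Q) → (Q → P) → χ P ≡ χ Q
  χ-cong f g = does-⇔ (mk⇔ f g) (em _) (em _)

  χ-sound : ∀ {p} {P : Set p} → χ P ≡ true → P
  χ-sound {P = P} eq with em _ {P}
  χ-sound eq | yes p = p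
  χ-sound () | no _

  by-contradiction : ∀ {p} {P : Set p} → ¬ ¬ P → P
  by-contradiction = decidable-stable (em _)

  -- The witness comes from `em`, not from the given proof of non-emptiness, so it depends on `P`
  -- alone. Predicates are Boolean-valued so that pointwise equivalent ones become equal by `ext`,
  -- and then have the same chosen element.
  choose : ∀ {k} {K : Set k} (P : K → Bool) → ∃ (λ x → P x ≡ true) → K
  choose P nonempty with em _ {∃ λ x → P x ≡ true}
  ... | yes (x , _) = x
  ... | no ¬nonempty = contradiction nonempty ¬nonempty

  choose-correct : ∀ {k} {K : Set k} (P : K → Bool) nonempty → P (choose P nonempty) ≡ true
  choose-correct P nonempty with em _ {∃ λ x → P x ≡ true}
  ... | yes (_ , p) = p
  ... | no ¬nonempty = contradiction nonempty ¬nonempty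

  choose-cong : ∀ {k} {K : Set k} {P Q : K → Bool} → P ≡ Q → ∀ p q → choose P p ≡ choose Q q
  choose-cong {P = P} refl p q with em _ {∃ λ x → P x ≡ true}
  ... | yes _ = refl
  ... | no ¬p = contradiction p ¬p

  -- An injective f need not respect the equality of S; it is replaced by a
  -- choice, depending only on the class of x, among the values f y with y ≈ x.
  injection : ∀ {a ℓ k} {S : Setoid a ℓ} {K : Set k} (f : Setoid.Carrier S → K) →
              Injective (Setoid._≈_ S) _≡_ f → ∣ S ∣≤ K
  injection {S = S} {K} f f-inj = record
    { to        = λ x → choose (codes x) (nonempty x)
    ; cong      = λ x≈y → choose-cong (ext _ _ (λ _ →
                    χ-cong (λ (z , z≈x , e) → z , ≈.trans z≈x x≈y , e)
                           (λ (z , z≈y , e) → z , ≈.trans z≈y (≈.sym x≈y) , e))) _ _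
    ; injective = λ {x} {y} e → code-inj (correct x) (subst (Code y) (sym e) (correct y))
    }
    where
    module ≈ = Setoid S
    Code : ≈.Carrier → K → Set _
    Code x k = ∃ λ y → y ≈.≈ x × f y ≡ k
    codes : ≈.Carrier → K → Bool
    codes x k = χ (Code x k)
    nonempty : ∀ x → ∃ λ k → codes x k ≡ true
    nonempty x = f x , χ-true (x , ≈.refl , refl)
    correct : ∀ x → Code x (choose (codes x) (nonempty x))
    correct x = χ-sound (choose-correct (codes x) (nonempty x))
    code-inj : ∀ {x y k} → Code x k → Code y k → x ≈.≈ y
    code-inj (u , u≈x , fu≡k) (v , v≈y , fv≡k) =
      ≈.trans (≈.sym u≈x) (≈.trans (f-inj (trans fu≡k (sym fv≡k))) v≈y)

  bijection : ∀ {a ℓ k} {S : Setoid a ℓ} {K : Set k} (h : K → Setoid.Carrier S) →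
              Injective _≡_ (Setoid._≈_ S) h → (∀ x → ∃ λ k → Setoid._≈_ S (h k) x) → ∣ S ∣≡ K
  bijection {S = S} h h-inj h-surj = record
    { to        = λ x → proj₁ (h-surj x)
    ; cong      = λ {x} {y} x≈y → h-inj (≈.trans (proj₂ (h-surj x)) (≈.trans x≈y (≈.sym (proj₂ (h-surj y)))))
    ; bijective = (λ {x} {y} e → ≈.trans (≈.sym (proj₂ (h-surj x)))
                                  (≈.trans (≈.reflexive (cong h e)) (proj₂ (h-surj y))))
                , (λ k → h k , λ {z} z≈hk → h-inj (≈.trans (proj₂ (h-surj z)) z≈hk))
    }
    where module ≈ = Setoid S

  enumerate : ∀ {p} n (P : Pred (Fin n) p) →
              Σ[ m ∈ ℕ ] Σ[ g ∈ (Fin m → Fin n) ]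
                Injective _≡_ _≡_ g × (∀ i → P (g i)) × (∀ k → P k → ∃ λ i → g i ≡ k)
  enumerate zero    P = zero , (λ ()) , (λ {}) , (λ ()) , λ ()
  enumerate (suc n) P with enumerate n (P ∘ suc) | em _ {P zero}
  ... | m , g , g-inj , g-in , g-onto | yes p₀ =
    suc m , g′
    , (λ { {zero} {zero} _ → refl ; {suc _} {suc _} e → cong suc (g-inj (suc-injective e)) })
    , (λ { zero → p₀ ; (suc i) → g-in i })
    , (λ { zero _ → zero , refl ; (suc k) p → suc (proj₁ (g-onto k p)) , cong suc (proj₂ (g-onto k p)) })
    where
    g′ : Fin (suc m) → Fin (suc n)
    g′ zero    = zero
    g′ (suc i) = suc (g i)
  ... | m , g , g-inj , g-in , g-onto | no ¬p₀ =
    m , suc ∘ g , (λ e → g-inj (suc-injective e)) , g-in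
    , (λ { zero p → contradiction p ¬p₀ ; (suc k) p → proj₁ (g-onto k p) , cong suc (proj₂ (g-onto k p)) })

  -- The code need not respect the equality of `S`: `injection` makes it do so, and `enumerate` then
  -- lists its range without repetitions. Both proofs of local finiteness below go through this
  -- criterion.
  finite : ∀ {a ℓ} {S : Setoid a ℓ} {n} (f : Setoid.Carrier S → Fin n) →
           Injective (Setoid._≈_ S) _≡_ f → Finite S
  finite {S = S} f f-inj with injection {S = S} f f-inj
  ... | ι with enumerate _ (λ k → ∃ λ x → Injection.to ι x ≡ k)
  ... | m , g , g-inj , g-in , g-onto = m , bijection {S = S} (λ i → proj₁ (g-in i))
    (λ {i} {j} x≈y → g-inj (trans (sym (proj₂ (g-in i))) (trans (Injection.cong ι x≈y) (proj₂ (g-in j)))))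
    (λ x → let i , e = g-onto _ (x , refl) in i , Injection.injective ι (trans (proj₂ (g-in i)) e))

  schröder-bernstein : ∀ {a ℓ k} {S : Setoid a ℓ} {K : Set k} → ∣ S ∣≤ K →
    (g : K → Setoid.Carrier S) → Injective _≡_ (Setoid._≈_ S) g → ∣ S ∣≡ K
  schröder-bernstein {S = S} {K} ι g g-inj = bijection {S = S} h h-inj h-surj
    where
    module ≈ = Setoid S
    f = Injection.to ι
    preimage : ∀ {x} → ¬ Moved f g x → ∃ λ s → f s ≡ x
    preimage ¬moved = by-contradiction λ none → ¬moved (base λ s e → none (s , e))
    h : K → ≈.Carrier
    h x with em _ {Moved f g x}
    ... | yes _ = g x
    ... | no ¬moved = proj₁ (preimage ¬moved)
    -- If `g x` were the chosen preimage of `y`, then `f (g x)` would be `y`, and `step` would put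
    -- `y` into `Moved`.
    moved-≉ : ∀ {x y} → Moved f g x → (¬moved : ¬ Moved f g y) → ¬ g x ≈.≈ proj₁ (preimage ¬moved)
    moved-≉ moved ¬moved gx≈s =
      ¬moved (subst (Moved f g) (trans (Injection.cong ι gx≈s) (proj₂ (preimage ¬moved))) (step moved))
    h-inj : Injective _≡_ ≈._≈_ h
    h-inj {x} {y} e with em _ {Moved f g x} | em _ {Moved f g y}
    ... | yes _ | yes _ = g-inj e
    ... | yes p | no ¬q = contradiction e (moved-≉ p ¬q)
    ... | no ¬p | yes q = contradiction (≈.sym e) (moved-≉ q ¬p)
    ... | no ¬p | no ¬q =
      trans (sym (proj₂ (preimage ¬p))) (trans (Injection.cong ι e) (proj₂ (preimage ¬q)))
    h-moved : ∀ {x} → Moved f g x → h x ≈.≈ g x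
    h-moved {x} p with em _ {Moved f g x}
    ... | yes _ = ≈.refl
    ... | no ¬p = contradiction p ¬p
    h-fixed : ∀ {s} → ¬ Moved f g (f s) → h (f s) ≈.≈ s
    h-fixed {s} ¬p with em _ {Moved f g (f s)}
    ... | yes p = contradiction p ¬p
    ... | no ¬q = Injection.injective ι (proj₂ (preimage ¬q))
    -- A value of `f` cannot enter `Moved` through `base`, so it has the form `f (g y)` with `y` in
    -- `Moved`; injectivity of `f` then gives `g y ≈ s`.
    moved-hit : ∀ {s x} → Moved f g x → x ≡ f s → ∃ λ y → h y ≈.≈ s
    moved-hit (base ¬f) e = contradiction (sym e) (¬f _)
    moved-hit (step {x} p) e = x , ≈.trans (h-moved p) (Injection.injective ι e)
    h-surj : ∀ s → ∃ λ x → h x ≈.≈ s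
    h-surj s with em _ {Moved f g (f s)}
    ... | yes p = moved-hit p refl
    ... | no ¬p = f s , h-fixed ¬p

  equipotent : ∀ {a ℓ b ℓ′ k} {S : Setoid a ℓ} {T : Setoid b ℓ′} {K : Set k} →
               ∣ S ∣≡ K → ∣ T ∣≡ K → Bijection S T
  equipotent S≡K T≡K = bijection-trans S≡K (sym-≡ T≡K)

  module _ {k} {K : Set k} (K-infinite : Infinite K) where

    abstract
      -- If a list contained every element, positions in the list would inject `K` into a finite
      -- set.
      outside : (xs : List K) → ∃ λ x → x ∉ xs
      outside xs = by-contradiction λ none →
        let member : ∀ x → x ∈ˡ xs
            member x = by-contradiction λ x∉xs → none (x , x∉xs)
        in K-infinite (finite {S = ≡-setoid K} (λ x → index (member x)) λ {x} {y} e →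
             trans (lookup-index (member x)) (trans (cong (lookup xs) e) (sym (lookup-index (member y)))))

      two-elements : Σ[ x ∈ K ] Σ[ y ∈ K ] x ≢ y
      two-elements =
        let x , _   = outside []
            y , y∉x = outside (x ∷ [])
        in x , y , λ x≡y → y∉x (here (sym x≡y))

  -- Local finiteness of the power, and changing one coordinate of a point.

  module _ {ℓ} (D : Set ℓ) (K : Group ℓ ℓ) where
    open Power D K
    private
      module K = Group K
      module P = Group power

    -- The points vanishing off F, indexed by their restrictions to F.
    points : (F : List D) → Fin (2 ^ length F) → Point
    points F k d with em _ {d ∈ˡ F}
    ... | yes d∈F = Inverse.to 2↔Bool (finToFun k (index d∈F))
    ... | no _ = false

    restriction : (F : List D) → Point → Fin (2 ^ length F)
    restriction F j = funToFin (Inverse.from 2↔Bool ∘ j ∘ lookup F)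

    points-restriction : ∀ F j → AgreeOn F j (points F (restriction F j))
    points-restriction F j {d} d∈F with em _ {d ∈ˡ F}
    ... | no d∉F = contradiction d∈F d∉F
    ... | yes m = sym (trans
      (cong (Inverse.to 2↔Bool) (finToFun-funToFin (Inverse.from 2↔Bool ∘ j ∘ lookup F) (index m)))
      (trans (Inverse.strictlyInverseˡ 2↔Bool (j (lookup F (index m))))
             (cong j (sym (lookup-index m)))))

    LocalOn : List D → LocallyConstant → Set ℓ
    LocalOn F f = ∀ {i j} → AgreeOn F i j → at f i K.≈ at f j

    determined-by-points : ∀ F f g → LocalOn F f → LocalOn F g →
      (∀ k → at f (points F k) K.≈ at g (points F k)) → f P.≈ g
    determined-by-points F f g f-loc g-loc e j =
      K.trans (f-loc (points-restriction F j))
        (K.trans (e _) (K.sym (g-loc (points-restriction F j))))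

    -- All elements generated by `g` are determined by their values at the finitely many points
    -- supported on `F`. These values lie in the subgroup of `K` generated by the values of the
    -- generators there, which is finite.
    power-locallyFinite : LocallyFinite K → LocallyFinite power
    power-locallyFinite K-lf n g = finite {S = subset P.setoid ⟨g⟩} code code-injective
      where
      ⟨g⟩ : Pred P.Carrier ℓ
      ⟨g⟩ = ⟨_⟩ power (λ f → ∃ λ i → f ≡ g i)
      F : List D
      F = concat (tabulate (support ∘ g))
      N : ℕ
      N = 2 ^ length F
      values : Fin (N * n) → K.Carrier
      values q = at (g (proj₂ (remQuot {N} n q))) (points F (proj₁ (remQuot {N} n q)))
      ⟨values⟩ : Pred K.Carrier ℓ
      ⟨values⟩ = ⟨_⟩ K (λ x → ∃ λ q → x ≡ values q)
      value∈ : ∀ k {f} → ⟨g⟩ f → ⟨values⟩ (at f (points F k))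
      value∈ k (gen (i , refl)) = gen (combine k i ,
        cong (λ (k , i) → at (g i) (points F k)) (sym (remQuot-combine k i)))
      value∈ k unit       = unit
      value∈ k (mult p q) = mult (value∈ k p) (value∈ k q)
      value∈ k (inv p)    = inv (value∈ k p)
      value∈ k (resp e p) = resp (e _) (value∈ k p)
      -- The list `support f` may exceed `F`, since `resp` replaces an element by an equal one with
      -- another support; only the dependence on `F` is inherited.
      localOn : ∀ {f} → ⟨g⟩ f → LocalOn F f
      localOn (gen (i , refl)) agree =
        local (g i) (λ d∈ → agree (∈-concat⁺′ d∈ (∈-tabulate⁺ i)))
      localOn unit       agree = K.refl
      localOn (mult p q) agree = K.∙-cong (localOn p agree) (localOn q agree)
      localOn (inv p)    agree = K.⁻¹-cong (localOn p agree)
      localOn (resp e p) agree = K.trans (K.sym (e _)) (K.trans (localOn p agree) (e _))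
      values-finite : Finite (subset K.setoid ⟨values⟩)
      values-finite = K-lf (N * n) values
      module V = Bijection (proj₂ values-finite)
      code : Σ P.Carrier ⟨g⟩ → Fin (proj₁ values-finite ^ N)
      code (f , p) = funToFin (λ k → V.to (at f (points F k) , value∈ k p))
      code-injective : Injective (Setoid._≈_ (subset P.setoid ⟨g⟩)) _≡_ code
      code-injective {f , p} {f′ , p′} e = determined-by-points F f f′ (localOn p) (localOn p′) λ k →
        V.injective (trans (sym (finToFun-funToFin _ k))
                    (trans (cong (λ c → finToFun c k) e) (finToFun-funToFin _ k)))

    _[_≔_] : Point → D → Bool → Point
    (j [ d ≔ b ]) d′ = if χ (d′ ≡ d) then b else j d′

    [≔]-same : ∀ j d b → (j [ d ≔ b ]) d ≡ b
    [≔]-same j d b rewrite χ-true {P = d ≡ d} refl = refl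

    [≔]-other : ∀ j {d d′} b → d′ ≢ d → (j [ d ≔ b ]) d′ ≡ j d′
    [≔]-other j b d′≢d rewrite χ-false d′≢d = refl

  -- The semidirect product with the Z/2-space on the cosets.

  module Wreath {ℓ} {G A : Group ℓ ℓ} (ι : G ≤ᴳ A) where
    private
      module G = Group G
      module A = Group A
    open GroupMorphisms G.rawGroup A.rawGroup using (IsGroupMonomorphism)
    private module ι = IsGroupMonomorphism (_≤ᴳ_.isGroupMonomorphism ι)
    open A using (_∙_; ε; _⁻¹; _≈_)
    open GroupProperties A using (⁻¹-anti-homo-∙; ⁻¹-involutive; \\-leftDividesʳ; ε⁻¹≈ε)
    incl = _≤ᴳ_.incl ι

    Image : Pred A.Carrier ℓ
    Image x = ∃ λ g → incl g ≈ x

    Image-resp : ∀ {x y} → x ≈ y → Image x → Image y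
    Image-resp x≈y (g , e) = g , A.trans e x≈y

    Image-∙ : ∀ {x y} → Image x → Image y → Image (x ∙ y)
    Image-∙ (g , e) (h , e′) = g G.∙ h , A.trans (ι.∙-homo g h) (A.∙-cong e e′)

    Image-⁻¹ : ∀ {x} → Image x → Image (x ⁻¹)
    Image-⁻¹ (g , e) = g G.⁻¹ , A.trans (ι.⁻¹-homo g) (A.⁻¹-cong e)

    Image-ε : Image ε
    Image-ε = G.ε , ι.ε-homo

    -- Equality of the left cosets of `Image` that contain `y` and `z`.
    _∼_ : A.Carrier → A.Carrier → Set ℓ
    y ∼ z = Image (y ⁻¹ ∙ z)

    ∼-reflexive : ∀ {y z} → y ≈ z → y ∼ z
    ∼-reflexive {y} {z} y≈z =
      Image-resp (A.trans (A.sym (A.inverseˡ y)) (A.∙-congˡ y≈z)) Image-ε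

    ∼-sym : ∀ {y z} → y ∼ z → z ∼ y
    ∼-sym {y} {z} p = Image-resp (A.trans (⁻¹-anti-homo-∙ (y ⁻¹) z) (A.∙-congˡ (⁻¹-involutive y)))
                                 (Image-⁻¹ p)

    ∼-trans : ∀ {x y z} → x ∼ y → y ∼ z → x ∼ z
    ∼-trans {x} {y} {z} p q = Image-resp
      (A.trans (A.assoc (x ⁻¹) y (y ⁻¹ ∙ z)) (A.∙-congˡ cancel)) (Image-∙ p q)
      where
      cancel : y ∙ (y ⁻¹ ∙ z) ≈ z
      cancel = A.trans (A.sym (A.assoc y (y ⁻¹) z))
                       (A.trans (A.∙-congʳ (A.inverseʳ y)) (A.identityˡ z))

    ∼-shift : ∀ {g y z} → (g ∙ y) ⁻¹ ∙ z ≈ y ⁻¹ ∙ (g ⁻¹ ∙ z)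
    ∼-shift {g} {y} {z} = A.trans (A.∙-congʳ (⁻¹-anti-homo-∙ g y)) (A.assoc (y ⁻¹) (g ⁻¹) z)

    -- A list stands for the sum, in the Z/2-space on A / Image, of the cosets of
    -- its entries; parity is the coordinate of this sum at the coset of z.
    parity : List A.Carrier → A.Carrier → Bool
    parity []       z = false
    parity (y ∷ ys) z = χ (y ∼ z) xor parity ys z

    parity-∼ : ∀ ys {z z′} → z ∼ z′ → parity ys z ≡ parity ys z′
    parity-∼ []       p = refl
    parity-∼ (y ∷ ys) p =
      cong₂ _xor_ (χ-cong (λ q → ∼-trans q p) (λ q → ∼-trans q (∼-sym p))) (parity-∼ ys p)

    parity-++ : ∀ ys zs z → parity (ys ++ zs) z ≡ parity ys z xor parity zs z
    parity-++ []       zs z = refl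
    parity-++ (y ∷ ys) zs z =
      trans (cong (χ (y ∼ z) xor_) (parity-++ ys zs z)) (sym (xor-assoc (χ (y ∼ z)) _ _))

    parity-map : ∀ g ys z → parity (map (g ∙_) ys) z ≡ parity ys (g ⁻¹ ∙ z)
    parity-map g []       z = refl
    parity-map g (y ∷ ys) z =
      cong₂ _xor_ (χ-cong (Image-resp ∼-shift) (Image-resp (A.sym ∼-shift))) (parity-map g ys z)

    parity-true : ∀ ys {z} → parity ys z ≡ true → ∃ λ y → y ∈ˡ ys × y ∼ z
    parity-true (y ∷ ys) {z} e with em _ {y ∼ z}
    ... | yes y∼z = y , here refl , y∼z
    ... | no _ with parity-true ys e
    ...   | y′ , y′∈ , y′∼z = y′ , there y′∈ , y′∼z

    Element : Set ℓ
    Element = List A.Carrier × A.Carrier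

    infix 4 _≋_
    _≋_ : Element → Element → Set ℓ
    (xs , x) ≋ (ys , y) = (∀ z → parity xs z ≡ parity ys z) × x ≈ y

    _⊛_ : Element → Element → Element
    (xs , x) ⊛ (ys , y) = xs ++ map (x ∙_) ys , x ∙ y

    _⊝ : Element → Element
    (xs , x) ⊝ = map (x ⁻¹ ∙_) xs , x ⁻¹

    parity-⊛ : ∀ xs x ys z → parity (xs ++ map (x ∙_) ys) z ≡ parity xs z xor parity ys (x ⁻¹ ∙ z)
    parity-⊛ xs x ys z = trans (parity-++ xs _ z) (cong (parity xs z xor_) (parity-map x ys z))

    parity-≈ : ∀ ys {z z′} → z ≈ z′ → parity ys z ≡ parity ys z′
    parity-≈ ys z≈z′ = parity-∼ ys (∼-reflexive z≈z′)

    -- The permutational wreath product of Z/2 by `A` acting on the left cosets of `Image`. In the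
    -- first component the laws reduce, through `parity-⊛`, to those of `xor` and of the action by
    -- translation.
    wreath : Group ℓ ℓ
    wreath = record
      { Carrier = Element
      ; _≈_     = _≋_
      ; _∙_     = _⊛_
      ; ε       = [] , ε
      ; _⁻¹     = _⊝
      ; isGroup = record
        { isMonoid = record
          { isSemigroup = record
            { isMagma = record
              { isEquivalence = record
                { refl  = (λ _ → refl) , A.refl
                ; sym   = λ (e , e′) → (λ z → sym (e z)) , A.sym e′
                ; trans = λ (e , e′) (f , f′) → (λ z → trans (e z) (f z)) , A.trans e′ f′
                }
              ; ∙-cong = λ {(xs , x)} {(xs′ , x′)} {(ys , y)} {(ys′ , y′)} (e , e′) (f , f′) →
                  (λ z → trans (parity-⊛ xs x ys z) (trans
                    (cong₂ _xor_ (e z) (trans (f (x ⁻¹ ∙ z)) (parity-≈ ys′ (A.∙-congʳ (A.⁻¹-cong e′)))))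
                    (sym (parity-⊛ xs′ x′ ys′ z))))
                  , A.∙-cong e′ f′
              }
            ; assoc = λ (xs , x) (ys , y) (zs , z) → ⊛-assoc xs x ys y zs , A.assoc x y z
            }
          ; identity =
              (λ (xs , x) →
                (λ z → trans (parity-map ε xs z) (parity-≈ xs (A.trans (A.∙-congʳ ε⁻¹≈ε) (A.identityˡ z))))
                , A.identityˡ x)
            , (λ (xs , x) →
                (λ z → trans (parity-++ xs [] z) (xor-identityʳ (parity xs z))) , A.identityʳ x)
          }
        ; inverse =
            (λ (xs , x) →
              (λ z → trans (parity-++ (map (x ⁻¹ ∙_) xs) _ z) (xor-same (parity (map (x ⁻¹ ∙_) xs) z)))
              , A.inverseˡ x)
          , (λ (xs , x) →
              (λ z → trans (parity-⊛ xs x _ z) (trans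
                (cong (parity xs z xor_) (trans (parity-map (x ⁻¹) xs (x ⁻¹ ∙ z))
                  (parity-≈ xs (\\-leftDividesʳ (x ⁻¹) z))))
                (xor-same (parity xs z))))
              , A.inverseʳ x)
        ; ⁻¹-cong = λ {(xs , x)} {(ys , y)} (e , e′) →
            (λ z → trans (parity-map (x ⁻¹) xs z) (trans (e (x ⁻¹ ⁻¹ ∙ z)) (trans
              (parity-≈ ys (A.∙-congʳ (A.⁻¹-cong (A.⁻¹-cong e′)))) (sym (parity-map (y ⁻¹) ys z)))))
            , A.⁻¹-cong e′
        }
      }
      where
      ⊛-assoc : ∀ xs x ys y zs z →
        parity ((xs ++ map (x ∙_) ys) ++ map ((x ∙ y) ∙_) zs) z ≡
        parity (xs ++ map (x ∙_) (ys ++ map (y ∙_) zs)) z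
      ⊛-assoc xs x ys y zs z = trans (parity-⊛ (xs ++ map (x ∙_) ys) (x ∙ y) zs z)
        (trans (cong₂ _xor_ (parity-⊛ xs x ys z) (parity-≈ zs ∼-shift))
        (trans (xor-assoc (parity xs z) _ _)
        (trans (cong (parity xs z xor_) (sym (parity-⊛ ys y zs (x ⁻¹ ∙ z))))
               (sym (parity-⊛ xs x _ z)))))

    private module W = Group wreath

    complement : A ≤ᴳ wreath
    complement = record
      { incl = λ x → [] , x
      ; isGroupMonomorphism = record
        { isGroupHomomorphism = ∙-homo⇒isGroupHomomorphism A wreath
            (λ x≈y → (λ _ → refl) , x≈y) (λ _ _ → (λ _ → refl) , A.refl)
        ; injective = proj₂
        }
      }

    open GroupMorphisms W.rawGroup W.rawGroup using (IsGroupHomomorphism)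

    retract : Element → Element
    retract (_ , x) = [] , x

    retract-homo : IsGroupHomomorphism retract
    retract-homo = ∙-homo⇒isGroupHomomorphism wreath wreath
      (λ (_ , x≈y) → (λ _ → refl) , x≈y) (λ _ _ → (λ _ → refl) , A.refl)

    -- The retraction followed by conjugation by the coset of ε.
    twist : Element → Element
    twist (_ , x) = ε ∷ x ∷ [] , x

    twist-homo : IsGroupHomomorphism twist
    twist-homo = ∙-homo⇒isGroupHomomorphism wreath wreath
      (λ {(_ , x)} {(_ , y)} (_ , x≈y) →
        (λ z → cong (λ b → χ (ε ∼ z) xor (b xor false)) (χ-∼ (∼-reflexive x≈y))) , x≈y)
      -- The product of the twists has the list `ε`, `x`, `x ∙ ε`, `x ∙ y`; the two middle entries
      -- name the same coset and cancel.
      (λ (_ , x) (_ , y) → (λ z → trans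
          (cancel (χ (ε ∼ z)) (χ (x ∼ z)) (χ ((x ∙ y) ∼ z)))
          (cong (λ b → χ (ε ∼ z) xor (χ (x ∼ z) xor (b xor (χ ((x ∙ y) ∼ z) xor false))))
             (χ-∼ (∼-reflexive (A.sym (A.identityʳ x))))))
        , A.refl)
      where
      χ-∼ : ∀ {x y z} → x ∼ y → χ (x ∼ z) ≡ χ (y ∼ z)
      χ-∼ p = χ-cong (∼-trans (∼-sym p)) (∼-trans p)
      cancel : ∀ b c d → b xor (d xor false) ≡ b xor (c xor (c xor (d xor false)))
      cancel b false d = refl
      cancel b true false = refl
      cancel b true true = refl

    -- The two entries `ε` and `incl g` lie in the same coset, so their sum vanishes.
    twist-fixes : ∀ g → twist ([] , incl g) ≋ ([] , incl g)
    twist-fixes g = (λ z → trans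
      (cong (λ b → χ (ε ∼ z) xor (b xor false)) (χ-cong (∼-trans g∼) (∼-trans (∼-sym g∼))))
      (trans (cong (χ (ε ∼ z) xor_) (xor-identityʳ _)) (xor-same (χ (ε ∼ z))))) , A.refl
      where
      g∼ : ε ∼ incl g
      g∼ = Image-resp (A.sym (A.trans (A.∙-congʳ ε⁻¹≈ε) (A.identityˡ (incl g)))) (g , A.refl)

    -- The coordinate at the coset of `ε` tells the images apart: in the twist, `ε` contributes one
    -- there and `x`, being outside `Image`, contributes nothing.
    twist-moves : ∀ {c} → ¬ Image (proj₂ c) → ¬ retract c ≋ twist c
    twist-moves {_ , x} x∉ (e , _) = contradiction (trans (e ε) value) λ ()
      where
      value : parity (ε ∷ x ∷ []) ε ≡ true
      value rewrite χ-true (∼-reflexive (A.refl {ε})) | χ-false {P = x ∼ ε} (λ p → x∉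
        (Image-resp (A.trans (A.∙-congʳ ε⁻¹≈ε) (A.identityˡ x)) (∼-sym p))) = refl

    -- If the `A`-part of `c` lies outside `Image`, the retraction and its twist differ at `c`. If
    -- it lies inside, the Z/2-part of `c` is nonzero, and the identity and the retraction differ.
    wreath-separated : Separated (ι ⨾ complement)
    wreath-separated c c∉ with em _ {Image (proj₂ c)}
    ... | no c₂∉ = retract , twist , (retract-homo , λ _ → (λ _ → refl) , A.refl) , (twist-homo , twist-fixes) ,
      twist-moves {c} c₂∉
    ... | yes (g , g≈c₂) = id , retract ,
      (Identity.isGroupHomomorphism W.rawGroup (λ {x} → W.refl {x}) , λ _ → (λ _ → refl) , A.refl) , (retract-homo , λ _ → (λ _ → refl) , A.refl) ,
      λ (e , _) → c∉ (g , (λ z → sym (e z)) , g≈c₂)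

    -- Needed for the size of the power even when `A` is trivial; the witness is the coset of `ε`.
    wreath-nontrivial : ∃ λ x → ¬ x W.≈ W.ε
    wreath-nontrivial = (ε ∷ [] , ε) , λ (e , _) →
      contradiction (trans (sym (trans (xor-identityʳ _) (χ-true (∼-reflexive A.refl)))) (e ε)) λ ()

    Supported : Pred A.Carrier ℓ → List A.Carrier → Pred A.Carrier ℓ
    Supported H E z = ∃ λ h → ∃ λ t → H h × t ∈ˡ E × (h ∙ t) ∼ z

    -- The `A`-parts of generated elements lie in a finite group `H`. Their Z/2-parts live on the
    -- finitely many cosets of products `h ∙ t` with `h` in `H` and `t` an entry of a generator, a
    -- set closed under translation by `H`. An element is thus coded by its `A`-part and finitely
    -- many bits.
    wreath-locallyFinite : LocallyFinite A → LocallyFinite wreath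
    wreath-locallyFinite A-lf n g = finite {S = subset W.setoid ⟨g⟩} code code-injective
      where
      ⟨g⟩ : Pred Element ℓ
      ⟨g⟩ = ⟨_⟩ wreath (λ c → ∃ λ i → c ≡ g i)
      H : Pred A.Carrier ℓ
      H = ⟨_⟩ A (λ x → ∃ λ i → x ≡ proj₂ (g i))
      H-finite : Finite (subset A.setoid H)
      H-finite = A-lf n (proj₂ ∘ g)
      module H = Bijection (proj₂ H-finite)
      E : List A.Carrier
      E = concat (tabulate (proj₁ ∘ g))

      proj₂∈H : ∀ {c} → ⟨g⟩ c → H (proj₂ c)
      proj₂∈H (gen (i , refl))  = gen (i , refl)
      proj₂∈H unit              = unit
      proj₂∈H (mult p q)        = mult (proj₂∈H p) (proj₂∈H q)
      proj₂∈H (inv p)           = inv (proj₂∈H p)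
      proj₂∈H (resp (_ , e) p)  = resp e (proj₂∈H p)

      supported-shift : ∀ {x z} → H x → Supported H E (x ⁻¹ ∙ z) → Supported H E z
      supported-shift {x} x∈H (h , t , h∈H , t∈E , p) = x ∙ h , t , mult x∈H h∈H , t∈E ,
        Image-resp (A.trans (A.sym ∼-shift) (A.∙-congʳ (A.⁻¹-cong (A.sym (A.assoc x h t))))) p

      supported : ∀ {c} → ⟨g⟩ c → ∀ {z} → parity (proj₁ c) z ≡ true → Supported H E z
      supported (gen (i , refl)) {z} e =
        let t , t∈ , t∼z = parity-true (proj₁ (g i)) e
        in ε , t , unit , ∈-concat⁺′ t∈ (∈-tabulate⁺ i) ,
           ∼-trans (∼-reflexive (A.identityˡ t)) t∼z
      -- The bit of a product at `z` is the `xor` of a bit of the first factor at `z` and a bit of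
      -- the second at `x ⁻¹ ∙ z`, so one of the two is set.
      supported (mult {xs , x} {ys , y} p q) {z} e
        with parity xs z in eq | trans (sym (parity-⊛ xs x ys z)) e
      ... | true  | _  = supported p eq
      ... | false | e′ = supported-shift (proj₂∈H p) (supported q e′)
      supported (inv {xs , x} p) {z} e =
        supported-shift (inv (proj₂∈H p)) (supported p (trans (sym (parity-map (x ⁻¹) xs z)) e))
      supported (resp (e , _) p) e′ = supported p (trans (e _) e′)

      H# = proj₁ H-finite
      E# = length E
      product : Fin H# × Fin E# → A.Carrier
      product (k , i) = proj₁ (H.to⁻ k) ∙ lookup E i
      -- Several indices may name the same coset, which is harmless for an injective code.
      representative : Fin (H# * E#) → A.Carrier
      representative = product ∘ remQuot E#

      representative-∼ : ∀ {z} → Supported H E z → ∃ λ q → representative q ∼ z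
      representative-∼ (h , t , h∈H , t∈E , p) =
        combine k (index t∈E) , ∼-trans (∼-reflexive same) p
        where
        k = H.to (h , h∈H)
        same : representative (combine k (index t∈E)) ≈ h ∙ t
        same = A.trans (A.reflexive (cong product (remQuot-combine k (index t∈E))))
          (A.∙-cong (H.injective (proj₂ (H.strictlySurjective k)))
                    (A.reflexive (sym (lookup-index t∈E))))

      parities : List A.Carrier → Fin (H# * E#) → Fin 2
      parities xs q = Inverse.from 2↔Bool (parity xs (representative q))

      code : Σ Element ⟨g⟩ → Fin (H# * 2 ^ (H# * E#))
      code ((xs , x) , p) = combine (H.to (x , proj₂∈H p)) (funToFin (parities xs))

      code-injective : Injective (Setoid._≈_ (subset W.setoid ⟨g⟩)) _≡_ code
      code-injective {(xs , x) , p} {(ys , y) , q} e = parity-≡ , H.injective (proj₁ e₁₂)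
        where
        e₁₂ = combine-injective (H.to (x , proj₂∈H p)) (funToFin (parities xs))
                                (H.to (y , proj₂∈H q)) (funToFin (parities ys)) e
        parities-≡ : ∀ i → parity xs (representative i) ≡ parity ys (representative i)
        parities-≡ i = Injection.injective (↔⇒↣ (↔-sym 2↔Bool))
          (trans (sym (finToFun-funToFin (parities xs) i))
          (trans (cong (λ c → finToFun c i) (proj₂ e₁₂)) (finToFun-funToFin (parities ys) i)))
        parity-≡ : ∀ z → parity xs z ≡ parity ys z
        parity-≡ z with em _ {Supported H E z}
        ... | yes s = let i , i∼z = representative-∼ s in
          trans (sym (parity-∼ xs i∼z)) (trans (parities-≡ i) (parity-∼ ys i∼z))
        ... | no ¬s = trans (¬-not (λ e → ¬s (supported p e))) (sym (¬-not (λ e → ¬s (supported q e))))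

    parity-determined : ∀ {m} {M : Set m} {f : A.Carrier → M} → Injective _≈_ _≡_ f →
                        ∀ xs ys → map f xs ≡ map f ys → ∀ z → parity xs z ≡ parity ys z
    parity-determined f-inj []       []       _ z = refl
    parity-determined f-inj (x ∷ xs) (y ∷ ys) e z = cong₂ _xor_
      (χ-cong (∼-trans (∼-reflexive (A.sym x≈y))) (∼-trans (∼-reflexive x≈y)))
      (parity-determined f-inj xs ys (∷-injectiveʳ e) z)
      where x≈y = f-inj (∷-injectiveˡ e)

    module _ {m} {M : Set m} (list : List M → M) (pair : M × M → M) (f : A.Carrier → M) where

      -- Different lists may represent the same element, so this code does not respect `_≋_`;
      -- `injection` repairs that.
      element-code : Element → M
      element-code (xs , x) = pair (list (map f xs) , f x)

      element-code-injective : Injective _≡_ _≡_ list → Injective _≡_ _≡_ pair → Injective _≈_ _≡_ f →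
                               Injective _≋_ _≡_ element-code
      element-code-injective list-inj pair-inj f-inj {xs , _} {ys , _} e =
        let e₁ , e₂ = ,-injective (pair-inj e)
        in parity-determined f-inj xs ys (list-inj e₁) , f-inj e₂

  -- Atomic types in the power.

  module Types {ℓ} {G₁ G₂ K : Group ℓ ℓ} (ι₁₂ : G₁ ≤ᴳ G₂) (κ : G₂ ≤ᴳ K) (D : Set ℓ) where
    open Power D K
    private
      module K = Group K
      module P = Group power
    open GroupMorphisms K.rawGroup K.rawGroup using (IsGroupHomomorphism)

    ι : G₁ ≤ᴳ power
    ι = ι₁₂ ⨾ (κ ⨾ diagonal)

    module _ {i} {I : Set i} where

      -- Words are evaluated pointwise and the parameters are constant functions fixed by `φ`. Hence
      -- the two points `j` and `j′` may differ.
      eval-homo : ∀ {φ} → EndomorphismOver (ι₁₂ ⨾ κ) φ → ∀ {a b : I → P.Carrier} {j j′} → (∀ β → at (a β) j K.≈ φ (at (b β) j′)) →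
        ∀ w → at (eval ι a w) j K.≈ φ (at (eval ι b w) j′)
      eval-homo (φ-homo , fixes) {a} {b} {j} {j′} a≈φb = go
        where
        module φ = IsGroupHomomorphism φ-homo
        go : ∀ w → at (eval ι a w) j K.≈ _
        go (var β)   = a≈φb β
        go (param g) = K.sym (fixes g)
        go one       = K.sym φ.ε-homo
        go (s · t)   = K.trans (K.∙-cong (go s) (go t)) (K.sym (φ.homo _ _))
        go (s ⁻)     = K.trans (K.⁻¹-cong (go s)) (K.sym (φ.⁻¹-homo _))

      eval-local : ∀ {a b : I → P.Carrier} {j j′} → (∀ β → at (a β) j K.≈ at (b β) j′) →
                   ∀ w → at (eval ι a w) j K.≈ at (eval ι b w) j′
      eval-local = eval-homo (Identity.isGroupHomomorphism K.rawGroup K.refl , λ _ → K.refl)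

      -- An equation is tested one point at a time, so it suffices that at each point the sequence
      -- looks like some realizer at some point; both may vary with `j`.
      realizes-local : ∀ {p} {Φ : Pred (Atomic I (Group.Carrier G₁)) p} {a : I → P.Carrier} →
        (∀ j → ∃ λ b → ∃ λ j′ → Realizes-at ι b Φ × (∀ β → at (a β) j K.≈ at (b β) j′)) →
        Realizes-at ι a Φ
      realizes-local pieces (s ≗ t) φ∈ j =
        let b , j′ , b-realizes , a≈b = pieces j
        in K.trans (eval-local a≈b s) (K.trans (b-realizes (s ≗ t) φ∈ j′) (K.sym (eval-local a≈b t)))

    mix-true : ∀ d f g {j} → j d ≡ true → at (mix d f g) j K.≈ at f j
    mix-true d f g e rewrite e = K.refl

    mix-false : ∀ d f g {j} → j d ≡ false → at (mix d f g) j K.≈ at g j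
    mix-false d f g e rewrite e = K.refl

    at-[≔] : ∀ f {j d b} → d ∉ support f → at f (_[_≔_] D K j d b) K.≈ at f j
    at-[≔] f {j} {d} {b} d∉ = local f λ d′∈ →
      [≔]-other D K j b λ d′≡d → d∉ (subst (_∈ˡ support f) d′≡d d′∈)

    mix-realizes : ∀ {i} {I : Set i} {p} {Φ : Pred (Atomic I (Group.Carrier G₁)) p}
      {d} {a b : I → P.Carrier} → Realizes-at ι a Φ → Realizes-at ι b Φ →
      Realizes-at ι (λ β → mix d (a β) (b β)) Φ
    mix-realizes {Φ = Φ} {d} {a} {b} a-realizes b-realizes = realizes-local λ j → piece j (j d) refl
      where
      piece : ∀ j c → j d ≡ c →
              ∃ λ e → ∃ λ j′ → Realizes-at ι e Φ × (∀ β → at (mix d (a β) (b β)) j K.≈ at (e β) j′)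
      piece j true  e = a , j , a-realizes , λ β → mix-true d (a β) (b β) e
      piece j false e = b , j , b-realizes , λ β → mix-false d (a β) (b β) e

  -- Coordinates avoiding the supports of a sequence.

  Coordinate : ∀ {ℓ} → Set ℓ → Set ℓ → Set ℓ
  Coordinate Λ M = M × (Λ → M)

  module Fresh {ℓ} {Λ M : Set ℓ} (outside : (xs : List M) → ∃ λ x → x ∉ xs)
               {i} {I : Set i} (I≤Λ : ∣ ≡-setoid I ∣≤ Λ) where
    module I = Injection I≤Λ

    D : Set ℓ
    D = Coordinate Λ M

    module _ (F : I → List D) where
      column : I → Λ → List M
      column β l = map (λ d → proj₂ d l) (F β)

      -- Cantor's diagonal: at the place of β it differs from every member of F β.
      diagonal : Λ → M
      diagonal l with em _ {∃ λ β → I.to β ≡ l}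
      ... | yes (β , _) = proj₁ (outside (column β l))
      ... | no _ = proj₁ (outside [])

      diagonal∉ : ∀ β → diagonal (I.to β) ∉ column β (I.to β)
      diagonal∉ β with em _ {∃ λ β′ → I.to β′ ≡ I.to β}
      ... | no none = contradiction (β , refl) none
      ... | yes (β′ , e) with I.injective e
      ...   | refl = proj₂ (outside (column β (I.to β)))

      -- The diagonal component alone keeps the coordinate out of every list, which leaves the first
      -- component free to give one fresh coordinate for each element of `M`.
      fresh : M → D
      fresh ε = ε , diagonal

      fresh-injective : Injective _≡_ _≡_ fresh
      fresh-injective = cong proj₁

      fresh∉ : ∀ ε β → fresh ε ∉ F β
      fresh∉ ε β ∈F = diagonal∉ β (∈-map⁺ (λ d → proj₂ d (I.to β)) ∈F)

  -- Intersections of agreement sets, and Δ-systems of realizers.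

  module ΔSystem {ℓ} {Λ M : Set ℓ} (outside : (xs : List M) → ∃ λ x → x ∉ xs)
                 {G₁ G₂ K : Group ℓ ℓ} (ι₁₂ : G₁ ≤ᴳ G₂) (κ : G₂ ≤ᴳ K)
                 {i} {I : Set i} (I≤Λ : ∣ ≡-setoid I ∣≤ Λ) where
    open Fresh {Λ = Λ} {M} outside I≤Λ
    open Power D K hiding (diagonal)
    open Types ι₁₂ κ D
    private
      module K = Group K
      module P = Group power
      _[_↦_] = _[_≔_] D K

    someM : M
    someM = proj₁ (outside [])

    -- One fresh bit `d` chooses between the `a` and the `b` sequences. Setting it to true or false
    -- recovers the agreement of either pair, because `d` lies outside all the supports.
    realizers-meet : ∀ {p} {Φ : Pred (Atomic I (Group.Carrier G₁)) p} {a′ a″ b′ b″ : I → P.Carrier} →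
      Realizes-at ι a′ Φ → Realizes-at ι a″ Φ → Realizes-at ι b′ Φ → Realizes-at ι b″ Φ →
      Σ[ c′ ∈ (I → P.Carrier) ] Σ[ c″ ∈ (I → P.Carrier) ]
        Realizes-at ι c′ Φ × Realizes-at ι c″ Φ ×
        ((λ β → a′ β P.≈ a″ β) ∩ (λ β → b′ β P.≈ b″ β)) ≐ (λ β → c′ β P.≈ c″ β)
    realizers-meet {a′ = a′} {a″} {b′} {b″} ra′ ra″ rb′ rb″ =
      c a′ b′ , c a″ b″ , mix-realizes ra′ rb′ , mix-realizes ra″ rb″ ,
      (λ {β} (a≈ , b≈) j → mixed β a≈ b≈ j (j d) refl) ,
      (λ {β} c≈ → (λ j → left β j (c≈ (on β j))) , (λ j → right β j (c≈ (off β j))))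
      where
      supportᵃ F : I → List D
      supportᵃ β = support (a′ β) ++ support (a″ β)
      F β = supportᵃ β ++ support (b′ β) ++ support (b″ β)
      d : D
      d = fresh F someM
      c : (I → P.Carrier) → (I → P.Carrier) → I → P.Carrier
      c a b β = mix d (a β) (b β)
      mixed : ∀ β → a′ β P.≈ a″ β → b′ β P.≈ b″ β → ∀ j v → j d ≡ v →
              at (c a′ b′ β) j K.≈ at (c a″ b″ β) j
      mixed β a≈ b≈ j true  e rewrite e = a≈ j
      mixed β a≈ b≈ j false e rewrite e = b≈ j
      module _ (β : I) (j : Point) where
        d∉ = fresh∉ F someM β
        on = j [ d ↦ true ]
        off = j [ d ↦ false ]
        left : at (c a′ b′ β) on K.≈ at (c a″ b″ β) on → at (a′ β) j K.≈ at (a″ β) j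
        left e = K.trans (K.sym (restore (a′ β) (b′ β) (d∉ ∘ ∈-++⁺ˡ ∘ ∈-++⁺ˡ)))
          (K.trans e (restore (a″ β) (b″ β) (d∉ ∘ ∈-++⁺ˡ ∘ ∈-++⁺ʳ (support (a′ β)))))
          where
          restore : ∀ f g → d ∉ support f → at (mix d f g) on K.≈ at f j
          restore f g d∉f = K.trans (mix-true d f g ([≔]-same D K j d true)) (at-[≔] f d∉f)
        right : at (c a′ b′ β) off K.≈ at (c a″ b″ β) off → at (b′ β) j K.≈ at (b″ β) j
        right e = K.trans (K.sym (restore (a′ β) (b′ β) (d∉ ∘ ∈-++⁺ʳ (supportᵃ β) ∘ ∈-++⁺ˡ)))
          (K.trans e (restore (a″ β) (b″ β) (d∉ ∘ ∈-++⁺ʳ (supportᵃ β) ∘ ∈-++⁺ʳ (support (b′ β)))))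
          where
          restore : ∀ f g → d ∉ support g → at (mix d f g) off K.≈ at g j
          restore f g d∉g = K.trans (mix-false d f g ([≔]-same D K j d false)) (at-[≔] g d∉g)

    module _ (ā a′ a″ : I → P.Carrier)
             (a′-realizes : Realizes-at ι a′ (tp-at ι ā)) (a″-realizes : Realizes-at ι a″ (tp-at ι ā)) where

      supports : I → List D
      supports β = support (ā β) ++ support (a′ β) ++ support (a″ β)

      pivot : D
      pivot = fresh supports someM

      -- Including `pivot` makes every switch a coordinate different from it.
      pivot∷supports : I → List D
      pivot∷supports β = pivot ∷ supports β

      switch : M → D
      switch = fresh pivot∷supports

      copies : M → I → P.Carrier
      copies ε β = mix pivot (ā β) (mix (switch ε) (a′ β) (a″ β))

      copies-on : ∀ ε β j → at (copies ε β) (j [ pivot ↦ true ]) K.≈ at (ā β) j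
      copies-on ε β j = K.trans (mix-true pivot (ā β) (mix (switch ε) (a′ β) (a″ β)) ([≔]-same D K j pivot true))
                                (at-[≔] (ā β) (fresh∉ supports someM β ∘ ∈-++⁺ˡ))

      copies-at : ∀ ε → Realizes-at ι (copies ε) (tp-at ι ā)
      copies-at ε = mix-realizes (λ _ φ∈ → φ∈) (mix-realizes a′-realizes a″-realizes)

      -- Equations survive mixing. An equation true of the copy holds in particular wherever the
      -- pivot is on, where the copy shows `ā`; since the pivot is outside the supports of `ā`, it
      -- would hold for `ā` at every point.
      copies-bs : ∀ ε → Realizes-bs ι (copies ε) (tp-bs ι ā)
      copies-bs ε (pos φ)       φ∈ = copies-at ε φ φ∈
      copies-bs ε (neg (s ≗ t)) φ∉ = λ s≈t → φ∉ λ j → K.trans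
        (K.sym (eval-local (λ β → copies-on ε β j) s))
        (K.trans (s≈t (j [ pivot ↦ true ])) (eval-local (λ β → copies-on ε β j) t))

      -- At `j₂` the pivot is off, the first switch on and the second off, so the copies show `a′`
      -- and `a″`. The three coordinates avoid the supports, so these values are the ones at `j`.
      copies-distinct : ∀ {ε₁ ε₂ β} → ε₁ ≢ ε₂ → copies ε₁ β P.≈ copies ε₂ β → a′ β P.≈ a″ β
      copies-distinct {ε₁} {ε₂} {β} ε₁≢ε₂ e j =
        K.trans (K.sym (K.trans first (restore (a′ β) (∈-++⁺ʳ (support (ā β)) ∘ ∈-++⁺ˡ))))
          (K.trans (e j₂) (K.trans second
            (restore (a″ β) (∈-++⁺ʳ (support (ā β)) ∘ ∈-++⁺ʳ (support (a′ β))))))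
        where
        j₀ j₁ j₂ : Point
        j₀ = j [ pivot ↦ false ]
        j₁ = j₀ [ switch ε₁ ↦ true ]
        j₂ = j₁ [ switch ε₂ ↦ false ]
        pivot≢ : ∀ ε → pivot ≢ switch ε
        pivot≢ ε e = fresh∉ pivot∷supports ε β (here (sym e))
        switch≢ : switch ε₁ ≢ switch ε₂
        switch≢ e = ε₁≢ε₂ (fresh-injective pivot∷supports e)
        j₂-pivot : j₂ pivot ≡ false
        j₂-pivot = trans ([≔]-other D K j₁ false (pivot≢ ε₂))
          (trans ([≔]-other D K j₀ true (pivot≢ ε₁)) ([≔]-same D K j pivot false))
        first : at (copies ε₁ β) j₂ K.≈ at (a′ β) j₂
        first = K.trans (mix-false pivot (ā β) (mix (switch ε₁) (a′ β) (a″ β)) j₂-pivot)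
          (mix-true (switch ε₁) (a′ β) (a″ β)
            (trans ([≔]-other D K j₁ false switch≢) ([≔]-same D K j₀ (switch ε₁) true)))
        second : at (copies ε₂ β) j₂ K.≈ at (a″ β) j₂
        second = K.trans (mix-false pivot (ā β) (mix (switch ε₂) (a′ β) (a″ β)) j₂-pivot)
          (mix-false (switch ε₂) (a′ β) (a″ β) ([≔]-same D K j₁ (switch ε₂) false))
        restore : ∀ f → (∀ {d} → d ∈ˡ support f → d ∈ˡ supports β) → at f j₂ K.≈ at f j
        restore f f⊆ = K.trans (at-[≔] f (fresh∉ pivot∷supports ε₂ β ∘ there ∘ f⊆))
          (K.trans (at-[≔] f (fresh∉ pivot∷supports ε₁ β ∘ there ∘ f⊆))
                   (at-[≔] f (fresh∉ supports someM β ∘ f⊆)))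

      copies-agree : ∀ ε₁ ε₂ {β} → a′ β P.≈ a″ β → copies ε₁ β P.≈ copies ε₂ β
      copies-agree ε₁ ε₂ a′≈a″ j with j pivot | j (switch ε₁) | j (switch ε₂)
      ... | true  | _     | _     = K.refl
      ... | false | true  | true  = K.refl
      ... | false | true  | false = a′≈a″ j
      ... | false | false | true  = K.sym (a′≈a″ j)
      ... | false | false | false = K.refl

      copies-Δ : ∀ {v} {u : Pred I v} → u ≐ (λ β → a′ β P.≈ a″ β) → IsΔSystem P.setoid ā copies u
      copies-Δ (u⊆ , ⊆u) ε₁ ε₂ β₁ β₂ once = mk⇔ to from
        where
        to : copies ε₁ β₁ P.≈ copies ε₂ β₂ → _
        -- Turning the pivot on reveals `ā`, so equal entries of two copies force equal entries of
        -- `ā`, and `once` then identifies the positions.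
        to e with once (λ j → K.trans (K.sym (copies-on ε₁ β₁ j)) (K.trans (e (j [ pivot ↦ true ])) (copies-on ε₂ β₂ j)))
        ... | refl with em _ {ε₁ ≡ ε₂}
        ...   | yes refl = inj₁ refl
        ...   | no ε₁≢ε₂ = inj₂ (refl , ⊆u (copies-distinct ε₁≢ε₂ e))
        from : _ → copies ε₁ β₁ P.≈ copies ε₂ β₂
        from (inj₁ refl)         = P.refl {copies ε₁ β₁}
        from (inj₂ (refl , β∈u)) = copies-agree ε₁ ε₂ (u⊆ β∈u)

  -- Elements pinned by a parameter, and coding of pairs.

  pinned-singleton : ∀ {a ℓ₁ b ℓ₂} {G : Group a ℓ₁} {H : Group b ℓ₂} (ι : G ≤ᴳ H) {c} g →
    Group._≈_ H (_≤ᴳ_.incl ι g) c → IsSingleton (Group.setoid H) (SameAtomicType ι c)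
  pinned-singleton {H = H} ι {c} g g≈c = c , (id , id) ,
    -- The equation of the variable with the parameter `g` belongs to the type of `c`.
    λ y (_ , ⊆y) → H.trans (⊆y {var Unit.tt ≗ param g} (H.sym g≈c)) g≈c
    where module H = Group H

  module Pairing {ℓ} {Λ M : Set ℓ} (encode : (Λ → M) → M) (encode-injective : Injective _≡_ _≡_ encode)
                 {l₀ l₁ : Λ} (l₀≢l₁ : l₀ ≢ l₁) where

    -- Pairs embed into functions on `Λ`, which `encode` maps into `M`; the second entry is read off
    -- at `l₁`.
    pair : M × M → M
    pair (x , y) = encode λ l → if χ (l ≡ l₀) then x else y

    pair-injective : Injective _≡_ _≡_ pair
    pair-injective {w , x} {y , z} e = cong₂ _,_
      (select (χ-true {P = l₀ ≡ l₀} refl) (at-place l₀))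
      (select (χ-false (l₀≢l₁ ∘ sym)) (at-place l₁))
      where
      at-place : ∀ l → (if χ (l ≡ l₀) then w else x) ≡ (if χ (l ≡ l₀) then y else z)
      at-place l = cong (λ f → f l) (encode-injective e)
      select : ∀ {b c} → b ≡ c → (if b then w else x) ≡ (if b then y else z) →
               (if c then w else x) ≡ (if c then y else z)
      select refl e = e

  -- The power of a separated group: cardinality, the dichotomy and the family of agreement sets.

  module Main {ℓ} {Λ M : Set ℓ} (Λ-infinite : Infinite Λ) (M-infinite : Infinite M)
              (encode : (Λ → M) → M) (encode-injective : Injective _≡_ _≡_ encode)
              {G₁ G₂ K : Group ℓ ℓ} (ι₁₂ : G₁ ≤ᴳ G₂) (κ : G₂ ≤ᴳ K) (G₁≤Λ : ∣ Group.setoid G₁ ∣≤ Λ)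
              (K-lf : LocallyFinite K) (K-separated : Separated (ι₁₂ ⨾ κ))
              (K-nontrivial : ∃ λ x → ¬ Group._≈_ K x (Group.ε K))
              (K≤M : ∣ Group.setoid K ∣≤ M) where

    D : Set ℓ
    D = Coordinate Λ M

    open Power D K using (Point; LocallyConstant; at; support; local; constant; mix; power; diagonal)
    open Types ι₁₂ κ D
    private
      module K = Group K
      module P = Group power
      module G₁≤Λ = Injection G₁≤Λ
      module K≤M = Injection K≤M

    l₀ : Λ
    l₀ = proj₁ (two-elements Λ-infinite)

    open Pairing encode encode-injective (proj₂ (proj₂ (two-elements Λ-infinite)))
    open Codes pair pair-injective (proj₂ (proj₂ (two-elements M-infinite)))

    coordinate-code : D → M
    coordinate-code (x , f) = pair (x , encode f)

    coordinate-code-injective : Injective _≡_ _≡_ coordinate-code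
    coordinate-code-injective e =
      let e₁ , e₂ = pair-injective₂ e in cong₂ _,_ e₁ (encode-injective e₂)

    values : (F : List D) → LocallyConstant → M
    values F f = tuple (2 ^ length F) (λ k → K≤M.to (at f (points D K F k)))

    -- The support fixes finitely many points, and the values there fix the function. Equal
    -- functions may carry different supports, which `injection` accounts for.
    power-code : LocallyConstant → M
    power-code f = pair (list (map coordinate-code (support f)) , values (support f) f)

    power-code-injective : Injective P._≈_ _≡_ power-code
    power-code-injective {f} {g} e = determined-by-points D K (support f) f g (local f)
      (subst (λ F → LocalOn D K F g) (sym F≡) (local g))
      (λ k → K≤M.injective (tuple-injective (2 ^ length (support f))
        (trans (proj₂ e₁₂) (cong (λ F → values F g) (sym F≡))) k))
      where
      e₁₂ = pair-injective₂ e
      F≡ : support f ≡ support g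
      F≡ = map-injective coordinate-code-injective {support f} {support g} (list-injective (proj₁ e₁₂))

    power≤M : ∣ P.setoid ∣≤ M
    power≤M = injection {S = P.setoid} power-code (λ {f} {g} → power-code-injective {f} {g})

    indicator : M → LocallyConstant
    indicator ε = mix (ε , λ _ → ε) (constant (proj₁ K-nontrivial)) (constant K.ε)

    indicator-injective : Injective _≡_ P._≈_ indicator
    indicator-injective {ε₁} {ε₂} e = by-contradiction λ ε₁≢ε₂ → proj₂ K-nontrivial
      -- At this point the coordinate of `ε₁` is on and that of `ε₂` is off.
      (separate (e (λ d → χ (proj₁ d ≡ ε₁))) (χ-true refl) (χ-false (ε₁≢ε₂ ∘ sym)))
      where
      separate : ∀ {x b c} → (if b then x else K.ε) K.≈ (if c then x else K.ε) →
                 b ≡ true → c ≡ false → x K.≈ K.ε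
      separate e refl refl = e

    power≡M : ∣ P.setoid ∣≡ M
    power≡M = schröder-bernstein power≤M indicator indicator-injective

    power-lf : LocallyFinite power
    power-lf = power-locallyFinite D K K-lf

    X : Pred P.Carrier ℓ
    X c = ∃ λ g → _≤ᴳ_.incl ι g P.≈ c

    X-resp : X Respects P._≈_
    X-resp c≈c′ (g , g≈c) = g , λ j → K.trans (g≈c j) (c≈c′ j)

    -- `X` is a copy of `G₁`, so each element is coded by the singleton of an index in `Λ`.
    X≤2^Λ : ∣ subset P.setoid X ∣≤ (Λ → Bool)
    X≤2^Λ = record
      { to        = λ (_ , g , _) l → χ (l ≡ G₁≤Λ.to g)
      ; cong      = λ {(_ , g , g≈c)} {(_ , g′ , g′≈c′)} c≈c′ →
          cong (λ k l → χ (l ≡ k)) (G₁≤Λ.cong (ι-injective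
            (λ j → K.trans (g≈c j) (K.trans (c≈c′ j) (K.sym (g′≈c′ j))))))
      ; injective = λ {(_ , g , g≈c)} {(_ , g′ , g′≈c′)} e →
          let g≈g′ = G₁≤Λ.injective (χ-sound (trans (sym (cong (λ f → f (G₁≤Λ.to g)) e)) (χ-true refl)))
          in λ j → K.trans (K.sym (g≈c j)) (K.trans (ι-cong g≈g′ j) (g′≈c′ j))
      }
      where
      open GroupMorphisms.IsGroupMonomorphism (_≤ᴳ_.isGroupMonomorphism ι)
        renaming (injective to ι-injective; ⟦⟧-cong to ι-cong)

    -- The Δ-system construction for sequences of length one: since `a′` and `a″` differ, its copies
    -- are pairwise different, one for each element of `M`.
    many-realizers : ∀ {c a′ a″} → Realizes-at ι ⟪ a′ ⟫ (tp-at ι ⟪ c ⟫) →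
      Realizes-at ι ⟪ a″ ⟫ (tp-at ι ⟪ c ⟫) → ¬ a′ P.≈ a″ →
      Bijection P.setoid (subset P.setoid (RealizesBasicType ι c))
    many-realizers {c} {a′} {a″} ra′ ra″ a′≉a″ = equipotent power≡M
      (schröder-bernstein {S = subset P.setoid (RealizesBasicType ι c)}
        (injection {S = subset P.setoid (RealizesBasicType ι c)} (power-code ∘ proj₁)
          (λ {x} {y} → power-code-injective {proj₁ x} {proj₁ y}))
        (λ ε → copies ⟪ c ⟫ ⟪ a′ ⟫ ⟪ a″ ⟫ ra′ ra″ ε Unit.tt , copies-bs ⟪ c ⟫ ⟪ a′ ⟫ ⟪ a″ ⟫ ra′ ra″ ε)
        (λ e → by-contradiction λ ε₁≢ε₂ →
          a′≉a″ (copies-distinct ⟪ c ⟫ ⟪ a′ ⟫ ⟪ a″ ⟫ ra′ ra″ ε₁≢ε₂ e)))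
      where
      ⊤≤Λ : ∣ ≡-setoid Unit.⊤ ∣≤ Λ
      ⊤≤Λ = record { to = λ _ → l₀ ; cong = λ _ → refl ; injective = λ _ → refl }
      open ΔSystem (outside M-infinite) ι₁₂ κ ⊤≤Λ

    origin : Point
    origin _ = false

    two-realizers : ∀ {c} → ¬ X c → Σ[ a′ ∈ P.Carrier ] Σ[ a″ ∈ P.Carrier ]
      Realizes-at ι ⟪ a′ ⟫ (tp-at ι ⟪ c ⟫) × Realizes-at ι ⟪ a″ ⟫ (tp-at ι ⟪ c ⟫) × ¬ a′ P.≈ a″
    two-realizers {c} c∉X with em _ {∃ λ j → ¬ at c j K.≈ at c origin}
    ... | yes (j , cj≉) = constant (at c j) , constant (at c origin) , value j , value origin ,
      λ e → cj≉ (e origin)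
      where
      value : ∀ j → Realizes-at ι ⟪ constant (at c j) ⟫ (tp-at ι ⟪ c ⟫)
      -- At every point this constant function looks like `c` at the fixed point `j`.
      value j = realizes-local λ _ → ⟪ c ⟫ , j , (λ _ φ∈ → φ∈) , λ _ → K.refl
    ... | no none = let φ , ψ , φ-over , ψ-over , φk≉ψk = K-separated k k∉ in
      constant (φ k) , constant (ψ k) , image-realizes φ-over , image-realizes ψ-over ,
      λ e → φk≉ψk (e origin)
      where
      k : K.Carrier
      k = at c origin
      c≈k : ∀ j → at c j K.≈ k
      c≈k j = by-contradiction λ cj≉ → none (j , cj≉)
      k∉ : ¬ (∃ λ g → _≤ᴳ_.incl (ι₁₂ ⨾ κ) g K.≈ k)
      k∉ (g , g≈k) = c∉X (g , λ j → K.trans g≈k (K.sym (c≈k j)))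
      image-realizes : ∀ {φ} → EndomorphismOver (ι₁₂ ⨾ κ) φ →
                       Realizes-at ι ⟪ constant (φ k) ⟫ (tp-at ι ⟪ c ⟫)
      image-realizes {φ} φ-over@(φ-homo , _) (s ≗ t) s≈t j = K.trans (image s) (K.trans
        (GroupMorphisms.IsGroupHomomorphism.⟦⟧-cong φ-homo (s≈t origin)) (K.sym (image t)))
        where
        image : ∀ w → at (eval ι ⟪ constant (φ k) ⟫ w) j K.≈ φ (at (eval ι ⟪ c ⟫ w) origin)
        image = eval-homo φ-over (λ _ → K.refl)

    dichotomy : ∀ c → ExactlyOne
      (X c × IsSingleton P.setoid (SameAtomicType ι c) ×
        (∀ (G₄ : Group ℓ ℓ) → LocallyFinite G₄ → (ι₃₄ : power ≤ᴳ G₄) →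
          IsSingleton (Group.setoid G₄) (SameAtomicType (ι ⨾ ι₃₄) (_≤ᴳ_.incl ι₃₄ c))))
      (Bijection P.setoid (subset P.setoid (RealizesBasicType ι c)))
    dichotomy c with em _ {X c}
    ... | yes (g , g≈c) = inj₁ (((g , g≈c) , pinned-singleton ι g g≈c ,
        λ G₄ _ ι₃₄ → pinned-singleton (ι ⨾ ι₃₄) g
          (GroupMorphisms.IsGroupMonomorphism.⟦⟧-cong (_≤ᴳ_.isGroupMonomorphism ι₃₄) g≈c)) , not-many)
      where
      not-many : ¬ Bijection P.setoid (subset P.setoid (RealizesBasicType ι c))
      -- All realizers equal `c`, so a bijection would identify the indicators of two different
      -- elements of `M`.
      not-many b = proj₂ (proj₂ (two-elements M-infinite)) (indicator-injective
        (B.injective {indicator _} {indicator _} (λ j →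
          K.trans (pinned (B.to (indicator _)) j) (K.sym (pinned (B.to (indicator _)) j)))))
        where
        module B = Bijection b
        pinned : (y : Σ P.Carrier (RealizesBasicType ι c)) → proj₁ y P.≈ c
        pinned (y , y-realizes) j =
          K.trans (y-realizes (pos (var Unit.tt ≗ param g)) (λ j → K.sym (g≈c j)) j) (g≈c j)
    ... | no c∉X = let _ , _ , ra′ , ra″ , a′≉a″ = two-realizers c∉X in
      inj₂ ((λ (c∈X , _) → c∉X c∈X) , many-realizers ra′ ra″ a′≉a″)

    module _ (α : Ordinal ℓ) (α<Λ⁺ : α < Λ ⁺) (ā : Ordinal.Index α → P.Carrier) where
      private I = Ordinal.Index α
      open ΔSystem (outside M-infinite) ι₁₂ κ α<Λ⁺

      -- The least family that contains every agreement set of two realizers and respects `_≐_`;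
      -- closure under intersections comes from `realizers-meet`.
      Agreements : Pred (Pred I ℓ) ℓ
      Agreements u = Σ[ a′ ∈ (I → P.Carrier) ] Σ[ a″ ∈ (I → P.Carrier) ]
        Realizes-at ι a′ (tp-at ι ā) × Realizes-at ι a″ (tp-at ι ā) × u ≐ (λ β → a′ β P.≈ a″ β)

      agreements-resp : ∀ u v → u ≐ v → u ∈ Agreements → v ∈ Agreements
      agreements-resp u v u≐v (a′ , a″ , ra′ , ra″ , u≐) =
        a′ , a″ , ra′ , ra″ , ≐-trans (≐-sym u≐v) u≐

      agreements-∩ : ∀ u v → u ∈ Agreements → v ∈ Agreements → (u ∩ v) ∈ Agreements
      agreements-∩ u v (a′ , a″ , ra′ , ra″ , u⊆ , ⊆u) (b′ , b″ , rb′ , rb″ , v⊆ , ⊆v) =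
        let c′ , c″ , rc′ , rc″ , ⊆c , c⊆ = realizers-meet ra′ ra″ rb′ rb″
        in c′ , c″ , rc′ , rc″ , (λ (β∈u , β∈v) → ⊆c (u⊆ β∈u , v⊆ β∈v))
                               , (λ e → let p , q = c⊆ e in ⊆u p , ⊆v q)

      agreements-⊤ : (λ _ → ⊤) ∈ Agreements
      agreements-⊤ = ā , ā , (λ _ φ∈ → φ∈) , (λ _ φ∈ → φ∈) , (λ {β} _ → P.refl {ā β}) , (λ _ → tt)

      agreements-Δ : ∀ u → u ∈ Agreements → Σ[ as ∈ (M → I → P.Carrier) ]
        IsΔSystem P.setoid ā as u ×
        (∀ ε → Realizes-at ι (as ε) (tp-at ι ā) × Realizes-bs ι (as ε) (tp-bs ι ā))
      agreements-Δ u (a′ , a″ , ra′ , ra″ , u≐) =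
        copies ā a′ a″ ra′ ra″ , copies-Δ ā a′ a″ ra′ ra″ u≐ ,
        λ ε → copies-at ā a′ a″ ra′ ra″ ε , copies-bs ā a′ a″ ra′ ra″ ε

claim2p6 :
  -- the ambient classical set theory: excluded middle for all types is also
  -- a choice operator, and with extensionality it yields the axiom of choice
  (∀ a → ExcludedMiddle a) →
  (∀ a b → Extensionality a b) →
  ∀ {ℓ : Level}
  (Λ : Set ℓ) → Infinite Λ →
  (M : Set ℓ) → Infinite M → M ⤖ (Λ → M) →
  (G₁ : Group ℓ ℓ) → LocallyFinite G₁ → ∣ Group.setoid G₁ ∣≤ Λ →
  (G₂ : Group ℓ ℓ) → LocallyFinite G₂ → ∣ Group.setoid G₂ ∣≤ M →
  (ι₁₂ : G₁ ≤ᴳ G₂) →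
  Σ[ G₃ ∈ Group ℓ ℓ ]
  Σ[ X ∈ Pred (Group.Carrier G₃) ℓ ]
  Σ[ ι₂₃ ∈ G₂ ≤ᴳ G₃ ]
  let open Group G₃
      ι₁₃ = ι₁₂ ⨾ ι₂₃
  in
  -- (a)
  (LocallyFinite G₃ × ∣ setoid ∣≡ M) ×
  -- (b)
  (X Respects _≈_ × ∣ subset setoid X ∣≤ (Λ → Bool)) ×
  -- (c)
  (∀ c → ExactlyOne
    (c ∈ X ×
     IsSingleton setoid (SameAtomicType ι₁₃ c) ×
     (∀ (G₄ : Group ℓ ℓ) → LocallyFinite G₄ → (ι₃₄ : G₃ ≤ᴳ G₄) →
       IsSingleton (Group.setoid G₄) (SameAtomicType (ι₁₃ ⨾ ι₃₄) (_≤ᴳ_.incl ι₃₄ c))))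
    (Bijection setoid (subset setoid (RealizesBasicType ι₁₃ c)))) ×
  -- (d), where the index ε < ‖G₃‖ ranges over M, which has cardinality ‖G₃‖ by (a)
  (∀ (α : Ordinal ℓ) → α < Λ ⁺ →
    let I = Ordinal.Index α in
    (ā : I → Carrier) →
    let p  = tp-at ι₁₃ ā
        p′ = tp-bs ι₁₃ ā
    in
    Σ[ 𝒫 ∈ Pred (Pred I ℓ) ℓ ]
      (∀ u v → u ≐ v → u ∈ 𝒫 → v ∈ 𝒫) ×
      Satisfiable 𝒫 ×
      (∀ u v → u ∈ 𝒫 → v ∈ 𝒫 → (u ∩ v) ∈ 𝒫) ×
      (λ _ → ⊤) ∈ 𝒫 ×
      (∀ (a′ a″ : I → Carrier) → Realizes-at ι₁₃ a′ p → Realizes-at ι₁₃ a″ p →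
        (λ β → a′ β ≈ a″ β) ∈ 𝒫) ×
      (∀ u → u ∈ 𝒫 →
        Σ[ as ∈ (M → I → Carrier) ]
          IsΔSystem setoid ā as u ×
          (∀ ε → Realizes-at ι₁₃ (as ε) p × Realizes-bs ι₁₃ (as ε) p′)))
claim2p6 em ext Λ Λ-infinite M M-infinite M⤖M^Λ G₁ _ G₁≤Λ G₂ G₂-lf G₂≤M ι₁₂ =
  power , X , complement ⨾ diagonal , (power-lf , power≡M) ,
  ((λ {c} {c′} → X-resp {c} {c′}) , X≤2^Λ) , dichotomy ,
  λ α α<Λ⁺ ā →
    Agreements α α<Λ⁺ ā , agreements-resp α α<Λ⁺ ā , (_ , agreements-⊤ α α<Λ⁺ ā) ,
    agreements-∩ α α<Λ⁺ ā , agreements-⊤ α α<Λ⁺ ā ,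
    (λ a′ a″ ra′ ra″ → a′ , a″ , ra′ , ra″ , ≐-refl) , agreements-Δ α α<Λ⁺ ā
  where
  open Classical em ext
  open Wreath ι₁₂
  module M^Λ = Bijection (sym-≡ M⤖M^Λ)
  open Pairing M^Λ.to M^Λ.injective (proj₂ (proj₂ (two-elements Λ-infinite)))
  open Codes pair pair-injective (proj₂ (proj₂ (two-elements M-infinite)))
  wreath≤M : ∣ Group.setoid wreath ∣≤ M
  wreath≤M = injection {S = Group.setoid wreath} (element-code list pair (Injection.to G₂≤M))
    (λ {x} {y} → element-code-injective list pair (Injection.to G₂≤M)
      list-injective pair-injective (Injection.injective G₂≤M) {x} {y})
  open Main Λ-infinite M-infinite M^Λ.to M^Λ.injective ι₁₂ complement G₁≤Λ
    (wreath-locallyFinite G₂-lf) wreath-separated wreath-nontrivial wreath≤M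
  open Power (Coordinate Λ M) wreath using (power; diagonal)
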